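{- For every $n\ge 1$ and every $f:\{0,1\}^n\to\{0,1\}$, $\mathrm{EC}(f)\le C(f)$.
   Context: Let $f:\{0,1\}^n\to\{0,1\}$ and $[n]=\{1,\dots,n\}$. Certificate complexity: an assignment is a map $A:[n]\to\{0,1,*\}$, identified with the subcube $\{x: \forall i,\ x_i=A(i)\text{ or }A(i)=*\}$; its size is $|A|=|\{i:A(i)\ne *\}|$. A $b$-certificate for $f$ is an assignment $A$ such that $x\in A\Rightarrow f(x)=b$. $C(f,x)$ is the size of the smallest $f(x)$-certificate consistent with $x$ (i.e. with $x\in A$), and $C(f)=\max_x C(f,x)$. The expectational certificate complexity $\mathrm{EC}(f)$ is the optimal value of the following program over families $\{w_x\}_{x\in\{0,1\}^n}$, $w_x\in\mathbb R^n$: minimize $\max_{x}\sum_{i=1}^n w_x(i)$ subject to $\sum_{i:x_i\ne y_i} w_x(i)w_y(i)\ge 1$ for all $x,y$ with $f(x)\ne f(y)$, and $0\le w_x(i)\le 1$ for all $x\in\{0,1\}^n$, $i\in[n]$. -}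

module Defs where

open import Data.Bool using (Bool; true; false)
import Data.Bool.Properties as Bool
open import Data.Fin using (Fin)
import Data.Fin.Properties as Fin
import Data.Integer as ℤ
open import Data.List as List using (List; []; _∷_; allFin; cartesianProductWith; filter; foldr)
open import Data.List.Extrema.Nat using (min; min≤xs; argmin-sel)
open import Data.List.Membership.Propositional using () renaming (_∈_ to _∈ˡ_)
open import Data.List.Membership.Propositional.Properties
  using (∈-cartesianProductWith⁺; ∈-filter⁺; ∈-filter⁻; ∈-map⁺; ∈-map⁻)
import Data.List.Relation.Unary.All as All
open import Data.List.Relation.Unary.Any using (here; there)
open import Data.Maybe using (Maybe; just; nothing; is-just)
import Data.Maybe.Properties as Maybe
open import Data.Nat using (ℕ; zero; suc)
import Data.Nat as ℕ
import Data.Nat.Properties as ℕ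
open import Data.Product using (∃; ∃-syntax; _×_; _,_; proj₁; proj₂)
open import Data.Rational
  using (ℚ; 0ℚ; 1ℚ; ½; _+_; _*_; _-_; -_; ∣_∣; _⊔_; _≤_; _<_; Positive; positive; 1/_)
import Data.Rational as ℚ
import Data.Rational.Properties as ℚ
open import Data.Rational.Solver using (module +-*-Solver)
open import Data.Sum using (_⊎_; inj₁; inj₂)
open import Data.Vec using (Vec; []; _∷_; lookup; countᵇ)
import Data.Vec as Vec
import Data.Vec.Properties as Vec
open import Function using (_∘_)
open import Relation.Binary.PropositionalEquality
open import Relation.Nullary using (Dec; ¬?)
open import Relation.Nullary.Decidable using (_×-dec_; _⊎-dec_; _→-dec_; map′)
open import Relation.Unary using (Decidable)

-- Cauchy sequences of rationals, not quotiented: _≤ℝ_ and _<ℝ_ respect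
-- equality of limits, _≡_ on ℝ is not the equality of real numbers.

IsCauchy : (ℕ → ℚ) → Set
IsCauchy a =
  ∀ ε → 0ℚ < ε → ∃[ N ] (∀ m n → N ℕ.≤ m → N ℕ.≤ n → ∣ a m - a n ∣ ≤ ε)

record ℝ : Set where
  constructor mkℝ
  field
    seq    : ℕ → ℚ
    cauchy : IsCauchy seq

open ℝ public

infix 4 _≤ℝ_ _<ℝ_

_≤ℝ_ : ℝ → ℝ → Set
x ≤ℝ y = ∀ ε → 0ℚ < ε → ∃[ N ] (∀ n → N ℕ.≤ n → seq x n ≤ seq y n + ε)

_<ℝ_ : ℝ → ℝ → Set
x <ℝ y = ∃[ ε ] (0ℚ < ε × ∃[ N ] (∀ n → N ℕ.≤ n → seq x n + ε ≤ seq y n))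

private
  open module Solver = +-*-Solver using (solve; con; _:=_; _:+_; _:*_; _:-_; :-_)

private abstract
  p≤∣p∣ : ∀ p → p ≤ ∣ p ∣
  p≤∣p∣ p with ℚ.≤-total 0ℚ p
  ... | inj₁ 0≤p = ℚ.≤-reflexive (sym (ℚ.0≤p⇒∣p∣≡p 0≤p))
  ... | inj₂ p≤0 = ℚ.≤-trans p≤0 (ℚ.0≤∣p∣ p)

  ∣p-q∣≡∣q-p∣ : ∀ p q → ∣ p - q ∣ ≡ ∣ q - p ∣
  ∣p-q∣≡∣q-p∣ p q = trans
    (cong ∣_∣ (solve 2 (λ p q → p :- q := :- (q :- p)) refl p q))
    (ℚ.∣-p∣≡∣p∣ (q - p))

  ∣-∣⇒≤ : ∀ p q {ε} → ∣ p - q ∣ ≤ ε → p ≤ q + ε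
  ∣-∣⇒≤ p q {ε} h = begin
    p             ≡⟨ solve 2 (λ p q → p := q :+ (p :- q)) refl p q ⟩
    q + (p - q)   ≤⟨ ℚ.+-monoʳ-≤ q (ℚ.≤-trans (p≤∣p∣ (p - q)) h) ⟩
    q + ε         ∎
    where open ℚ.≤-Reasoning

  ≤⇒-≤ : ∀ p q {ε} → p ≤ q + ε → p - q ≤ ε
  ≤⇒-≤ p q {ε} h = begin
    p - q         ≤⟨ ℚ.+-monoˡ-≤ (- q) h ⟩
    (q + ε) - q   ≡⟨ solve 2 (λ q e → (q :+ e) :- q := e) refl q ε ⟩
    ε             ∎
    where open ℚ.≤-Reasoning

  ≤⇒∣-∣ : ∀ p q {ε} → p ≤ q + ε → q ≤ p + ε → ∣ p - q ∣ ≤ ε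
  ≤⇒∣-∣ p q {ε} h₁ h₂ with ℚ.∣p∣≡p∨∣p∣≡-p (p - q)
  ... | inj₁ e = subst (_≤ ε) (sym e) (≤⇒-≤ p q h₁)
  ... | inj₂ e = subst (_≤ ε)
    (sym (trans e (solve 2 (λ p q → :- (p :- q) := q :- p) refl p q)))
    (≤⇒-≤ q p h₂)

  0<½* : ∀ {ε} → 0ℚ < ε → 0ℚ < ½ * ε
  0<½* {ε} 0<ε = ℚ.positive⁻¹ _ ⦃ ℚ.pos*pos⇒pos ½ ε ⦃ positive 0<ε ⦄ ⦄

  halves : ∀ ε → ½ * ε + ½ * ε ≡ ε
  halves = solve 1 (λ e → con ½ :* e :+ con ½ :* e := e) refl

  ≤-both : ∀ {K L m} → K ℕ.⊔ L ℕ.≤ m → K ℕ.≤ m × L ℕ.≤ m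
  ≤-both {K} {L} h =
    ℕ.≤-trans (ℕ.m≤m⊔n K L) h , ℕ.≤-trans (ℕ.m≤n⊔m K L) h

  divide : ∀ K → Positive K → ∀ ε → 0ℚ < ε → ∃[ δ ] (0ℚ < δ × K * δ ≡ ε)
  divide K K>0 ε 0<ε = r * ε , 0<r*ε , K*r*ε≡ε
    where
    K≢0 : ℚ.NonZero K
    K≢0 = ℚ.pos⇒nonZero K ⦃ K>0 ⦄
    r : ℚ
    r = (1/ K) ⦃ K≢0 ⦄
    r>0 : Positive r
    r>0 = ℚ.1/pos⇒pos K ⦃ K>0 ⦄
    0<r*ε : 0ℚ < r * ε
    0<r*ε = ℚ.positive⁻¹ (r * ε) ⦃ ℚ.pos*pos⇒pos r ⦃ r>0 ⦄ ε ⦃ positive 0<ε ⦄ ⦄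
    K*r*ε≡ε : K * (r * ε) ≡ ε
    K*r*ε≡ε = trans (sym (ℚ.*-assoc K r ε))
      (trans (cong (_* ε) (ℚ.*-inverseʳ K ⦃ K≢0 ⦄)) (ℚ.*-identityˡ ε))

  scaled-cauchy : ∀ {a} K → Positive K →
    (∀ ε → 0ℚ < ε →
      ∃[ N ] (∀ m n → N ℕ.≤ m → N ℕ.≤ n → ∣ a m - a n ∣ ≤ K * ε)) →
    IsCauchy a
  scaled-cauchy {a} K K>0 h ε 0<ε =
    let δ , 0<δ , K*δ≡ε = divide K K>0 ε 0<ε
        N , c           = h δ 0<δ
    in N , λ m n Nm Nn → subst (∣ a m - a n ∣ ≤_) K*δ≡ε (c m n Nm Nn)

  +-cauchy : ∀ {a b} → IsCauchy a → IsCauchy b → IsCauchy (λ n → a n + b n)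
  +-cauchy {a} {b} ca cb ε 0<ε =
    let M , f = ca (½ * ε) (0<½* 0<ε)
        N , g = cb (½ * ε) (0<½* 0<ε)
    in M ℕ.⊔ N , λ m n hm hn → begin
      ∣ (a m + b m) - (a n + b n) ∣     ≡⟨ cong ∣_∣ (solve 4 (λ p q r s →
                                             (p :+ q) :- (r :+ s) := (p :- r) :+ (q :- s))
                                             refl (a m) (b m) (a n) (b n)) ⟩
      ∣ (a m - a n) + (b m - b n) ∣     ≤⟨ ℚ.∣p+q∣≤∣p∣+∣q∣ (a m - a n) (b m - b n) ⟩
      ∣ a m - a n ∣ + ∣ b m - b n ∣     ≤⟨ ℚ.+-mono-≤
                                             (f m n (proj₁ (≤-both hm)) (proj₁ (≤-both hn)))
                                             (g m n (proj₂ (≤-both {M} hm)) (proj₂ (≤-both {M} hn))) ⟩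
      ½ * ε + ½ * ε                     ≡⟨ halves ε ⟩
      ε                                 ∎
    where open ℚ.≤-Reasoning

  ⊔-cauchy : ∀ {a b} → IsCauchy a → IsCauchy b → IsCauchy (λ n → a n ⊔ b n)
  ⊔-cauchy {a} {b} ca cb ε 0<ε =
    let M , f = ca ε 0<ε
        N , g = cb ε 0<ε
        half = λ m n hm hn → ℚ.⊔-lub
          (ℚ.≤-trans (∣-∣⇒≤ (a m) (a n) (f m n (proj₁ (≤-both hm)) (proj₁ (≤-both hn))))
                     (ℚ.+-monoˡ-≤ ε (ℚ.p≤p⊔q (a n) (b n))))
          (ℚ.≤-trans (∣-∣⇒≤ (b m) (b n) (g m n (proj₂ (≤-both {M} hm)) (proj₂ (≤-both {M} hn))))
                     (ℚ.+-monoˡ-≤ ε (ℚ.p≤q⊔p (a n) (b n))))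
    in M ℕ.⊔ N , λ m n hm hn →
      ≤⇒∣-∣ (a m ⊔ b m) (a n ⊔ b n) (half m n hm hn) (half n m hn hm)

  bound : ∀ {a} → IsCauchy a →
    ∃[ B ] (Positive B × ∃[ N ] (∀ m → N ℕ.≤ m → ∣ a m ∣ ≤ B))
  bound {a} ca =
    let N , f = ca 1ℚ (ℚ.positive⁻¹ 1ℚ)
    in 1ℚ + ∣ a N ∣ , ℚ.pos+nonNeg⇒pos 1ℚ ∣ a N ∣ ⦃ ℚ.nonNegative (ℚ.0≤∣p∣ (a N)) ⦄ ,
       N , λ m hm → begin
      ∣ a m ∣                    ≡⟨ cong ∣_∣ (solve 2 (λ p q → p := (p :- q) :+ q) refl (a m) (a N)) ⟩
      ∣ (a m - a N) + a N ∣      ≤⟨ ℚ.∣p+q∣≤∣p∣+∣q∣ (a m - a N) (a N) ⟩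
      ∣ a m - a N ∣ + ∣ a N ∣    ≤⟨ ℚ.+-monoˡ-≤ ∣ a N ∣ (f m N hm ℕ.≤-refl) ⟩
      1ℚ + ∣ a N ∣               ∎
    where open ℚ.≤-Reasoning

  *-mono-∣∣ : ∀ p q {r s} → Positive r → ∣ p ∣ ≤ r → ∣ q ∣ ≤ s → ∣ p * q ∣ ≤ r * s
  *-mono-∣∣ p q {r} {s} r>0 pr qs = begin
    ∣ p * q ∣        ≡⟨ ℚ.∣p*q∣≡∣p∣*∣q∣ p q ⟩
    ∣ p ∣ * ∣ q ∣    ≤⟨ ℚ.*-monoʳ-≤-nonNeg ∣ q ∣ ⦃ ℚ.nonNegative (ℚ.0≤∣p∣ q) ⦄ pr ⟩
    r * ∣ q ∣        ≤⟨ ℚ.*-monoˡ-≤-nonNeg r ⦃ ℚ.pos⇒nonNeg r ⦃ r>0 ⦄ ⦄ qs ⟩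
    r * s            ∎
    where open ℚ.≤-Reasoning

  product-difference : ∀ p q r s → p * q - r * s ≡ p * (q - s) + s * (p - r)
  product-difference = solve 4 (λ p q r s →
    p :* q :- r :* s := p :* (q :- s) :+ s :* (p :- r)) refl

  *-estimate : ∀ p q r s {A B ε} → Positive A → Positive B →
    ∣ p ∣ ≤ A → ∣ s ∣ ≤ B → ∣ q - s ∣ ≤ ε → ∣ p - r ∣ ≤ ε →
    ∣ p * q - r * s ∣ ≤ (A + B) * ε
  *-estimate p q r s {A} {B} {ε} A>0 B>0 pA sB qs pr = begin
    ∣ p * q - r * s ∣                    ≡⟨ cong ∣_∣ (product-difference p q r s) ⟩
    ∣ p * (q - s) + s * (p - r) ∣        ≤⟨ ℚ.∣p+q∣≤∣p∣+∣q∣ (p * (q - s)) (s * (p - r)) ⟩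
    ∣ p * (q - s) ∣ + ∣ s * (p - r) ∣    ≤⟨ ℚ.+-mono-≤ (*-mono-∣∣ p (q - s) A>0 pA qs)
                                                      (*-mono-∣∣ s (p - r) B>0 sB pr) ⟩
    A * ε + B * ε                        ≡⟨ sym (ℚ.*-distribʳ-+ ε A B) ⟩
    (A + B) * ε                          ∎
    where open ℚ.≤-Reasoning

  *-cauchy : ∀ {a b} → IsCauchy a → IsCauchy b → IsCauchy (λ n → a n * b n)
  *-cauchy {a} {b} ca cb =
    let A , A>0 , K , boundA = bound {a} ca
        B , B>0 , L , boundB = bound {b} cb
    in scaled-cauchy {λ n → a n * b n} (A + B) (ℚ.pos+pos⇒pos A ⦃ A>0 ⦄ B ⦃ B>0 ⦄) λ ε 0<ε →
    let M , f = ca ε 0<ε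
        N , g = cb ε 0<ε
    in (K ℕ.⊔ L) ℕ.⊔ (M ℕ.⊔ N) , λ m n hm hn →
      let KL≤m , MN≤m = ≤-both {K ℕ.⊔ L} {M ℕ.⊔ N} hm
          KL≤n , MN≤n = ≤-both {K ℕ.⊔ L} {M ℕ.⊔ N} hn
      in *-estimate (a m) (b m) (a n) (b n) A>0 B>0
           (boundA m (proj₁ (≤-both {K} {L} KL≤m)))
           (boundB n (proj₂ (≤-both {K} {L} KL≤n)))
           (g m n (proj₂ (≤-both {M} {N} MN≤m)) (proj₂ (≤-both {M} {N} MN≤n)))
           (f m n (proj₁ (≤-both {M} {N} MN≤m)) (proj₁ (≤-both {M} {N} MN≤n)))

  const-cauchy : ∀ q → IsCauchy (λ _ → q)
  const-cauchy q ε 0<ε = 0 , λ _ _ _ _ →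
    subst (_≤ ε) (sym (cong ∣_∣ (ℚ.+-inverseʳ q))) (ℚ.<⇒≤ 0<ε)

infixl 6 _+ℝ_ _⊔ℝ_
infixl 7 _*ℝ_

_+ℝ_ _*ℝ_ _⊔ℝ_ : ℝ → ℝ → ℝ
x +ℝ y = mkℝ (λ n → seq x n + seq y n) (+-cauchy {seq x} {seq y} (cauchy x) (cauchy y))
x *ℝ y = mkℝ (λ n → seq x n * seq y n) (*-cauchy {seq x} {seq y} (cauchy x) (cauchy y))
x ⊔ℝ y = mkℝ (λ n → seq x n ⊔ seq y n) (⊔-cauchy {seq x} {seq y} (cauchy x) (cauchy y))

fromℚ : ℚ → ℝ
fromℚ q = mkℝ (λ _ → q) (const-cauchy q)

fromℕ : ℕ → ℝ
fromℕ n = fromℚ (ℤ.+ n ℚ./ 1)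

0ℝ 1ℝ : ℝ
0ℝ = fromℚ 0ℚ
1ℝ = fromℚ 1ℚ

∑ : ∀ {A : Set} → List A → (A → ℝ) → ℝ
∑ is g = foldr (λ i s → g i +ℝ s) 0ℝ is

-- Constructively the infimum of a set of reals need not be a Cauchy real,
-- but it is always determined by the rationals strictly above it.

record ℝᵘ : Set₁ where
  field
    Above   : ℚ → Set
    upward  : ∀ {q r} → q ≤ r → Above q → Above r
    rounded : ∀ {q} → Above q → ∃[ r ] (r < q × Above r)

open ℝᵘ public

infix 4 _≤ᵘ_

_≤ᵘ_ : ℝᵘ → ℝᵘ → Set
x ≤ᵘ y = ∀ q → Above y q → Above x q

↑ : ℝ → ℝᵘ
↑ x = record
  { Above   = λ q → x <ℝ fromℚ q
  ; upward  = λ { q≤r (ε , 0<ε , N , h) →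
      ε , 0<ε , N , λ n hn → ℚ.≤-trans (h n hn) q≤r }
  ; rounded = λ { {q} (ε , 0<ε , N , h) →
      q - ½ * ε
    , subst (q - ½ * ε <_) (ℚ.+-identityʳ q)
        (ℚ.+-monoʳ-< q (ℚ.neg-antimono-< (0<½* 0<ε)))
    , ½ * ε , 0<½* 0<ε , N
    , λ n hn → begin
        seq x n + ½ * ε            ≡⟨ solve 2 (λ x e →
                                        x :+ con ½ :* e := (x :+ e) :- con ½ :* e)
                                        refl (seq x n) ε ⟩
        (seq x n + ε) - ½ * ε      ≤⟨ ℚ.+-monoˡ-≤ (- (½ * ε)) (h n hn) ⟩
        q - ½ * ε                  ∎ }
  }
  where open ℚ.≤-Reasoning

⨅ : {I : Set} → (I → ℝᵘ) → ℝᵘ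
⨅ x = record
  { Above   = λ q → ∃[ i ] Above (x i) q
  ; upward  = λ { q≤r (i , a) → i , upward (x i) q≤r a }
  ; rounded = λ { (i , a) → let r , r<q , b = rounded (x i) a in r , r<q , i , b }
  }

⨅-lower : ∀ {I : Set} (x : I → ℝᵘ) i → ⨅ x ≤ᵘ x i
⨅-lower x i q a = i , a

⨅-greatest : ∀ {I : Set} (x : I → ℝᵘ) y → (∀ i → y ≤ᵘ x i) → y ≤ᵘ ⨅ x
⨅-greatest x y h q (i , a) = h i q a

↑-mono : ∀ {x y} → x ≤ℝ y → ↑ x ≤ᵘ ↑ y
↑-mono {x} {y} x≤y q (ε , 0<ε , N , h) =
  let M , g = x≤y (½ * ε) (0<½* 0<ε)
  in ½ * ε , 0<½* 0<ε , M ℕ.⊔ N , λ n hn → begin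
    seq x n + ½ * ε              ≤⟨ ℚ.+-monoˡ-≤ (½ * ε) (g n (proj₁ (≤-both hn))) ⟩
    (seq y n + ½ * ε) + ½ * ε    ≡⟨ solve 2 (λ y e →
                                      (y :+ con ½ :* e) :+ con ½ :* e := y :+ e)
                                      refl (seq y n) ε ⟩
    seq y n + ε                  ≤⟨ h n (proj₂ (≤-both {M} hn)) ⟩
    q                            ∎
  where open ℚ.≤-Reasoning

private abstract
  quarters : ∀ q ε → (q + ½ * (½ * ε) + ½ * (½ * ε)) + ½ * ε ≡ q + ε
  quarters = solve 2 (λ q e →
    (q :+ con ½ :* (con ½ :* e) :+ con ½ :* (con ½ :* e)) :+ con ½ :* e := q :+ e) refl

  ↑-cancel-step : ∀ p q r {ε η} → 0ℚ < ε → 0ℚ < η →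
    p + η ≤ (q + ½ * (½ * ε)) + ½ * ε → q ≤ r + ½ * (½ * ε) → p ≤ r + ε
  ↑-cancel-step p q r {ε} {η} 0<ε 0<η h₁ h₂ = begin
    p                                            ≡⟨ sym (ℚ.+-identityʳ p) ⟩
    p + 0ℚ                                       ≤⟨ ℚ.+-monoʳ-≤ p (ℚ.<⇒≤ 0<η) ⟩
    p + η                                        ≤⟨ h₁ ⟩
    (q + ½ * (½ * ε)) + ½ * ε                    ≤⟨ ℚ.+-monoˡ-≤ (½ * ε) (ℚ.+-monoˡ-≤ (½ * (½ * ε)) h₂) ⟩
    ((r + ½ * (½ * ε)) + ½ * (½ * ε)) + ½ * ε    ≡⟨ quarters r ε ⟩
    r + ε                                        ∎
    where open ℚ.≤-Reasoning

↑-cancel : ∀ {x y} → ↑ x ≤ᵘ ↑ y → x ≤ℝ y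
↑-cancel {x} {y} h ε 0<ε =
  let N , c           = cauchy y (½ * (½ * ε)) (0<½* (0<½* 0<ε))
      η , 0<η , M , g = h ((seq y N + ½ * (½ * ε)) + ½ * ε)
        ( ½ * ε , 0<½* 0<ε , N
        , λ n hn → ℚ.+-monoˡ-≤ (½ * ε)
            (∣-∣⇒≤ (seq y n) (seq y N) (c n N hn ℕ.≤-refl)))
  in M ℕ.⊔ N , λ n hn →
    ↑-cancel-step (seq x n) (seq y N) (seq y n) 0<ε 0<η
      (g n (proj₁ (≤-both {M} {N} hn)))
      (∣-∣⇒≤ (seq y N) (seq y n) (c N n ℕ.≤-refl (proj₂ (≤-both {M} {N} hn))))

Cube : ℕ → Set
Cube n = Vec Bool n

words : ∀ {A : Set} → List A → ∀ n → List (Vec A n)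
words as zero    = [] ∷ []
words as (suc n) = cartesianProductWith _∷_ as (words as n)

∈-words : ∀ {A : Set} {as : List A} → (∀ a → a ∈ˡ as) →
          ∀ {n} (v : Vec A n) → v ∈ˡ words as n
∈-words all []      = here refl
∈-words all (a ∷ v) = ∈-cartesianProductWith⁺ _∷_ (all a) (∈-words all v)

bools : List Bool
bools = false ∷ true ∷ []

∈-bools : ∀ b → b ∈ˡ bools
∈-bools false = here refl
∈-bools true  = there (here refl)

allCube? : ∀ {n} {P : Cube n → Set} → Decidable P → Dec (∀ x → P x)
allCube? {n} P? = map′
  (λ ps x → All.lookup ps (∈-words ∈-bools x))
  (λ p → All.tabulate (λ {x} _ → p x))
  (All.all? P? (words bools n))

-- Recursive in n, so that no default value is needed.
maxOver : ∀ {A : Set} → (A → A → A) → ∀ n → (Cube n → A) → A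
maxOver _⊔_ zero    g = g []
maxOver _⊔_ (suc n) g =
  maxOver _⊔_ n (g ∘ (false ∷_)) ⊔ maxOver _⊔_ n (g ∘ (true ∷_))

-- nothing stands for *
Assignment : ℕ → Set
Assignment n = Vec (Maybe Bool) n

infix 4 _∈_ _∈?_

_∈_ : ∀ {n} → Cube n → Assignment n → Set
x ∈ A = ∀ i → just (lookup x i) ≡ lookup A i ⊎ lookup A i ≡ nothing

size : ∀ {n} → Assignment n → ℕ
size A = countᵇ is-just A

IsCertificate : ∀ {n} → Bool → (Cube n → Bool) → Assignment n → Set
IsCertificate b f A = ∀ x → x ∈ A → f x ≡ b

_∈?_ : ∀ {n} (x : Cube n) A → Dec (x ∈ A)
x ∈? A = Fin.all? λ i →
  Maybe.≡-dec Bool._≟_ (just (lookup x i)) (lookup A i)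
  ⊎-dec Maybe.≡-dec Bool._≟_ (lookup A i) nothing

isCertificate? : ∀ {n} b (f : Cube n → Bool) A → Dec (IsCertificate b f A)
isCertificate? b f A = allCube? λ x → (x ∈? A) →-dec (f x Bool.≟ b)

stars : List (Maybe Bool)
stars = nothing ∷ just false ∷ just true ∷ []

∈-stars : ∀ a → a ∈ˡ stars
∈-stars nothing      = here refl
∈-stars (just false) = there (here refl)
∈-stars (just true)  = there (there (here refl))

certificates : ∀ {n} → (Cube n → Bool) → Cube n → List (Assignment n)
certificates {n} f x =
  filter (λ A → isCertificate? (f x) f A ×-dec (x ∈? A)) (words stars n)

-- The default value n of min does not interfere: x itself, read as an
-- assignment without stars, is a certificate of size n (see C-at-attained).
C-at : ∀ {n} → (Cube n → Bool) → Cube n → ℕ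
C-at {n} f x = min n (List.map size (certificates f x))

C : ∀ {n} → (Cube n → Bool) → ℕ
C {n} f = maxOver ℕ._⊔_ n (C-at f)

C-at-lower : ∀ {n} (f : Cube n → Bool) x A →
             IsCertificate (f x) f A → x ∈ A → C-at f x ℕ.≤ size A
C-at-lower {n} f x A cert x∈A =
  All.lookup (min≤xs n (List.map size (certificates f x)))
    (∈-map⁺ size (∈-filter⁺ _ (∈-words ∈-stars A) (cert , x∈A)))

C-at-attained : ∀ {n} (f : Cube n → Bool) x →
                ∃[ A ] (IsCertificate (f x) f A × x ∈ A × size A ≡ C-at f x)
C-at-attained {n} f x with argmin-sel (λ k → k) n (List.map size (certificates f x))
... | inj₁ e = Vec.map just x , full-cert , full-∈ x , trans (size-full x) (sym e)
  where
  full-∈ : ∀ {m} (y : Cube m) → y ∈ Vec.map just y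
  full-∈ y i = inj₁ (sym (Vec.lookup-map i just y))

  size-full : ∀ {m} (y : Cube m) → size (Vec.map just y) ≡ m
  size-full []      = refl
  size-full (_ ∷ y) = cong suc (size-full y)

  unique : ∀ {m} (z y : Cube m) → z ∈ Vec.map just y → z ≡ y
  unique []      []      _ = refl
  unique (b ∷ z) (c ∷ y) h with h Fin.zero
  ... | inj₁ refl = cong (b ∷_) (unique z y (λ i → h (Fin.suc i)))

  full-cert : IsCertificate (f x) f (Vec.map just x)
  full-cert y h = cong f (unique y x h)
... | inj₂ e with ∈-map⁻ size e
...   | A , A∈ , eq with ∈-filter⁻ _ {xs = words stars n} A∈
...     | _ , cert , x∈A = A , cert , x∈A , sym eq

Weights : ℕ → Set
Weights n = Cube n → Fin n → ℝ

differing : ∀ {n} → Cube n → Cube n → List (Fin n)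
differing {n} x y = filter (λ i → ¬? (lookup x i Bool.≟ lookup y i)) (allFin n)

record Feasible {n} (f : Cube n → Bool) (w : Weights n) : Set where
  field
    separates   : ∀ x y → f x ≢ f y →
                  1ℝ ≤ℝ ∑ (differing x y) (λ i → w x i *ℝ w y i)
    nonNegative : ∀ x i → 0ℝ ≤ℝ w x i
    atMostOne   : ∀ x i → w x i ≤ℝ 1ℝ

objective : ∀ {n} → Weights n → ℝ
objective {n} w = maxOver _⊔ℝ_ n (λ x → ∑ (allFin n) (w x))

-- Above (EC f) q says that some feasible w has objective strictly below q.
EC : ∀ {n} → (Cube n → Bool) → ℝᵘ
EC f = ⨅ {∃ (Feasible f)} (λ (w , _) → ↑ (objective w))

-- Let w_x be the indicator of the coordinates fixed by a minimal certificate
-- A_x of x, so that its total weight is C(f, x). If f(x) ≠ f(y), the subcubes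
-- A_x and A_y are disjoint, so they disagree on a coordinate that both fix;
-- there x and y differ, and w_x(i) w_y(i) = 1.

module Submission where

open import Defs
open import Data.Bool using (Bool; true; false)
open import Data.Bool.Properties using (_≟_)
open import Data.Fin using (Fin; zero; suc)
open import Data.Fin.Properties using (any?)
open import Data.Integer as ℤ using (+_; +≤+)
import Data.Integer.Properties as ℤ
open import Data.List using ([]; _∷_; allFin; tabulate)
open import Data.List.Membership.Propositional using () renaming (_∈_ to _∈ˡ_)
open import Data.List.Membership.Propositional.Properties using (∈-filter⁺; ∈-allFin)
open import Data.List.Relation.Unary.Any using (here; there)
open import Data.Maybe using (Maybe; just; nothing; Is-just)
open import Data.Maybe.Relation.Unary.Any using (just; dec)
open import Data.Nat using (ℕ; zero; suc; _≤_; _⊔_)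
import Data.Nat.Properties as ℕ
open import Data.Product using (_×_; _,_; ∃-syntax; proj₁; proj₂)
open import Data.Rational as ℚ using (ℚ; 0ℚ; 1ℚ; toℚᵘ)
import Data.Rational.Properties as ℚ
open import Data.Rational.Unnormalised as ℚᵘ using (mkℚᵘ; *≡*; *≤*)
import Data.Rational.Unnormalised.Properties as ℚᵘ
open import Data.Sum using (inj₁; inj₂)
import Data.Vec as Vec
open import Data.Vec using ([]; _∷_; lookup)
open import Data.Vec.Properties using (lookup∘tabulate)
open import Data.Unit using (tt)
open import Function using (_∘_; id)
open import Relation.Binary.PropositionalEquality
open import Relation.Nullary using (Dec; yes; no; ¬_; contradiction; ¬?; _×-dec_)

-- The reals compared below are all built from constant sequences, so an index-by-index comparison
-- is enough and leaves only rational arithmetic.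
≤-seq⇒≤ℝ : ∀ {x y} → (∀ k → seq x k ℚ.≤ seq y k) → x ≤ℝ y
≤-seq⇒≤ℝ {x} {y} h ε 0<ε = 0 , λ k _ → begin
  seq x k            ≤⟨ h k ⟩
  seq y k            ≡⟨ sym (ℚ.+-identityʳ (seq y k)) ⟩
  seq y k ℚ.+ 0ℚ     ≤⟨ ℚ.+-monoʳ-≤ (seq y k) (ℚ.<⇒≤ 0<ε) ⟩
  seq y k ℚ.+ ε      ∎
  where open ℚ.≤-Reasoning

-- Division in `ℚ` cancels a gcd and so does not compute for a variable `m`; the unnormalised
-- fraction does.
toℚᵘ-ℕ : ∀ m → toℚᵘ (+ m ℚ./ 1) ℚᵘ.≃ mkℚᵘ (+ m) 0
toℚᵘ-ℕ m = ℚ.toℚᵘ-fromℚᵘ (mkℚᵘ (+ m) 0)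

suc/1 : ∀ m → 1ℚ ℚ.+ + m ℚ./ 1 ≡ + suc m ℚ./ 1
suc/1 m = ℚ.toℚᵘ-injective (begin
  toℚᵘ (1ℚ ℚ.+ + m ℚ./ 1)               ≈⟨ ℚ.toℚᵘ-homo-+ 1ℚ (+ m ℚ./ 1) ⟩
  toℚᵘ 1ℚ ℚᵘ.+ toℚᵘ (+ m ℚ./ 1)         ≈⟨ ℚᵘ.+-congʳ (toℚᵘ 1ℚ) (toℚᵘ-ℕ m) ⟩
  toℚᵘ 1ℚ ℚᵘ.+ mkℚᵘ (+ m) 0             ≈⟨ *≡* (cong (λ p → (+ 1 ℤ.+ p) ℤ.* + 1) (ℤ.*-identityʳ (+ m))) ⟩
  mkℚᵘ (+ suc m) 0                      ≈⟨ ℚᵘ.≃-sym (toℚᵘ-ℕ (suc m)) ⟩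
  toℚᵘ (+ suc m ℚ./ 1)                  ∎)
  where open ℚᵘ.≃-Reasoning

/1-mono-≤ : ∀ {m n} → m ≤ n → + m ℚ./ 1 ℚ.≤ + n ℚ./ 1
/1-mono-≤ {m} {n} m≤n = ℚ.toℚᵘ-cancel-≤ (begin
  toℚᵘ (+ m ℚ./ 1)    ≃⟨ toℚᵘ-ℕ m ⟩
  mkℚᵘ (+ m) 0        ≤⟨ *≤* (ℤ.*-monoʳ-≤-nonNeg (+ 1) (+≤+ m≤n)) ⟩
  mkℚᵘ (+ n) 0        ≃⟨ ℚᵘ.≃-sym (toℚᵘ-ℕ n) ⟩
  toℚᵘ (+ n ℚ./ 1)    ∎)
  where open ℚᵘ.≤-Reasoning

module _ {A : Set} (g : A → ℝ) (k : ℕ) (g≥0 : ∀ i → 0ℚ ℚ.≤ seq (g i) k) where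
  ∑-nonNegative : ∀ is → 0ℚ ℚ.≤ seq (∑ is g) k
  ∑-nonNegative []       = ℚ.≤-refl
  ∑-nonNegative (i ∷ is) = ℚ.+-mono-≤ (g≥0 i) (∑-nonNegative is)

  -- The other terms are nonnegative. This lets a single separating coordinate bound the whole
  -- constraint sum from below.
  term≤∑ : ∀ {i is} → i ∈ˡ is → seq (g i) k ℚ.≤ seq (∑ is g) k
  term≤∑ {i} {_ ∷ is} (here refl) = subst (ℚ._≤ seq (∑ (i ∷ is) g) k)
    (ℚ.+-identityʳ (seq (g i) k)) (ℚ.+-monoʳ-≤ (seq (g i) k) (∑-nonNegative is))
  term≤∑ {i} {j ∷ is} (there i∈is) = subst (ℚ._≤ seq (∑ (j ∷ is) g) k)
    (ℚ.+-identityˡ (seq (g i) k)) (ℚ.+-mono-≤ (g≥0 j) (term≤∑ i∈is))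

maxOver-upper : ∀ n (g : Cube n → ℕ) x → g x ≤ maxOver _⊔_ n g
maxOver-upper zero    g []          = ℕ.≤-refl
maxOver-upper (suc n) g (false ∷ x) =
  ℕ.≤-trans (maxOver-upper n (g ∘ (false ∷_)) x) (ℕ.m≤m⊔n _ _)
maxOver-upper (suc n) g (true ∷ x)  =
  ℕ.≤-trans (maxOver-upper n (g ∘ (true ∷_)) x)
    (ℕ.m≤n⊔m (maxOver _⊔_ n (g ∘ (false ∷_))) _)

maxOver-lub : ∀ n (g : Cube n → ℝ) {q} k → (∀ x → seq (g x) k ℚ.≤ q) →
              seq (maxOver _⊔ℝ_ n g) k ℚ.≤ q
maxOver-lub zero    g k h = h []
maxOver-lub (suc n) g k h = ℚ.⊔-lub
  (maxOver-lub n (g ∘ (false ∷_)) k (h ∘ (false ∷_)))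
  (maxOver-lub n (g ∘ (true ∷_)) k (h ∘ (true ∷_)))

fixed : Maybe Bool → ℚ
fixed (just _) = 1ℚ
fixed nothing  = 0ℚ

fixed≥0 : ∀ a → 0ℚ ℚ.≤ fixed a
fixed≥0 (just _) = ℚ.nonNegative⁻¹ 1ℚ
fixed≥0 nothing  = ℚ.≤-refl

fixed≤1 : ∀ a → fixed a ℚ.≤ 1ℚ
fixed≤1 (just _) = ℚ.≤-refl
fixed≤1 nothing  = ℚ.nonNegative⁻¹ 1ℚ

fixed*fixed≥0 : ∀ a b → 0ℚ ℚ.≤ fixed a ℚ.* fixed b
fixed*fixed≥0 (just _) b = subst (0ℚ ℚ.≤_) (sym (ℚ.*-identityˡ (fixed b))) (fixed≥0 b)
fixed*fixed≥0 nothing  b = ℚ.≤-reflexive (sym (ℚ.*-zeroˡ (fixed b)))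

fixed-just : ∀ {a} → Is-just a → fixed a ≡ 1ℚ
fixed-just (just _) = refl

-- The case needed is `h = id`, since `allFin` is `tabulate id`; a general `h` lets the induction on
-- `A` pass to `h ∘ suc`.
∑-fixed : ∀ {m} {I : Set} (A : Assignment m) (h : Fin m → I) (g : I → ℝ) k →
          (∀ i → seq (g (h i)) k ≡ fixed (lookup A i)) →
          seq (∑ (tabulate h) g) k ≡ + size A ℚ./ 1
∑-fixed []             h g k eq = refl
∑-fixed (just _ ∷ A)   h g k eq = trans
  (cong₂ ℚ._+_ (eq zero) (∑-fixed A (h ∘ suc) g k (eq ∘ suc))) (suc/1 (size A))
∑-fixed (nothing ∷ A)  h g k eq = trans
  (cong₂ ℚ._+_ (eq zero) (∑-fixed A (h ∘ suc) g k (eq ∘ suc))) (ℚ.+-identityˡ _)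

-- For `x ∈ A` and `y ∈ B` this says that `A` and `B` fix `i` to different values. It is phrased
-- through `x` and `y` because the constraint sums over the coordinates where these differ.
Separates : ∀ {n} → Assignment n → Assignment n → Cube n → Cube n → Fin n → Set
Separates A B x y i =
  lookup x i ≢ lookup y i × Is-just (lookup A i) × Is-just (lookup B i)

separates? : ∀ {n} (A B : Assignment n) x y i → Dec (Separates A B x y i)
separates? A B x y i = ¬? (lookup x i ≟ lookup y i) ×-dec
  dec (λ _ → yes tt) (lookup A i) ×-dec dec (λ _ → yes tt) (lookup B i)

-- With no separating coordinate, overwriting y by x on the coordinates fixed
-- by A gives a point of both subcubes.
meet : ∀ {n} (A B : Assignment n) x y → x ∈ A → y ∈ B →
       ¬ (∃[ i ] Separates A B x y i) → ∃[ z ] (z ∈ A × z ∈ B)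
meet {n} A B x y x∈A y∈B none = Vec.tabulate z , z∈A , z∈B
  where
  choose : Maybe Bool → Fin n → Bool
  choose (just _) = lookup x
  choose nothing  = lookup y

  z : Fin n → Bool
  z i = choose (lookup A i) i

  z∈A : Vec.tabulate z ∈ A
  z∈A i rewrite lookup∘tabulate z i with lookup A i | x∈A i
  ... | just _  | x≡A = x≡A
  ... | nothing | _   = inj₂ refl

  z∈B : Vec.tabulate z ∈ B
  z∈B i rewrite lookup∘tabulate z i
    -- `none` at `i` is abstracted together with the lookups, so that its type follows their cases.
    -- Where both assignments fix `i`, it forces `x` and `y` to agree there.
    with lookup A i | lookup B i | y∈B i | (λ x≢y a b → none (i , x≢y , a , b))
  ... | nothing | _       | y≡B       | _ = y≡B
  ... | just _  | nothing | _         | _ = inj₂ refl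
  ... | just _  | just _  | inj₁ refl | agree with lookup x i ≟ lookup y i
  ...   | yes x≡y = inj₁ (cong just x≡y)
  ...   | no  x≢y = contradiction (just tt) (agree x≢y (just tt))

-- A common point `z` of the two subcubes would give `f x ≡ f z ≡ f y`. Since separation is
-- decidable and there are finitely many coordinates, excluding this case yields an actual
-- coordinate.
certificates-separate : ∀ {n} (f : Cube n → Bool) A B x y →
  IsCertificate (f x) f A → IsCertificate (f y) f B → x ∈ A → y ∈ B →
  f x ≢ f y → ∃[ i ] Separates A B x y i
certificates-separate f A B x y certA certB x∈A y∈B fx≢fy
  with any? (separates? A B x y)
... | yes found = found
... | no  none  =
  let z , z∈A , z∈B = meet A B x y x∈A y∈B none
  in contradiction (trans (sym (certA z z∈A)) (certB z z∈B)) fx≢fy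

module _ {n} (f : Cube n → Bool) where
  minimal : Cube n → Assignment n
  minimal x = proj₁ (C-at-attained f x)

  weights : Weights n
  weights x i = fromℚ (fixed (lookup (minimal x) i))

  feasible : Feasible f weights
  feasible = record
    { separates   = λ x y fx≢fy →
        let _ , certA , x∈A , _ = C-at-attained f x
            _ , certB , y∈B , _ = C-at-attained f y
            i , x≢y , a , b = certificates-separate f (minimal x) (minimal y) x y
                                certA certB x∈A y∈B fx≢fy
            g = λ j → weights x j *ℝ weights y j
        in ≤-seq⇒≤ℝ {1ℝ} {∑ (differing x y) g} λ k →
          -- The term at the separating coordinate `i` is `1ℚ ℚ.* 1ℚ`, which computes to the
          -- required `1ℚ`.
          subst (ℚ._≤ seq (∑ (differing x y) g) k)
            (cong₂ ℚ._*_ (fixed-just a) (fixed-just b))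
            (term≤∑ g k (λ j → fixed*fixed≥0 (lookup (minimal x) j) (lookup (minimal y) j))
              (∈-filter⁺ _ (∈-allFin i) x≢y))
    ; nonNegative = λ x i → ≤-seq⇒≤ℝ {0ℝ} {weights x i} λ _ → fixed≥0 (lookup (minimal x) i)
    ; atMostOne   = λ x i → ≤-seq⇒≤ℝ {weights x i} {1ℝ} λ _ → fixed≤1 (lookup (minimal x) i)
    }

  total-weight : ∀ x k → seq (∑ (allFin n) (weights x)) k ≡ + C-at f x ℚ./ 1
  total-weight x k = trans (∑-fixed (minimal x) id (weights x) k (λ _ → refl))
    (cong (λ m → + m ℚ./ 1) (proj₂ (proj₂ (proj₂ (C-at-attained f x)))))

  objective≤C : objective weights ≤ℝ fromℕ (C f)
  objective≤C = ≤-seq⇒≤ℝ {objective weights} {fromℕ (C f)} λ k →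
    maxOver-lub n _ k λ x →
      subst (ℚ._≤ + C f ℚ./ 1) (sym (total-weight x k))
        (/1-mono-≤ (maxOver-upper n (C-at f) x))

lemma10 : (n : ℕ) → 1 ≤ n → (f : Cube n → Bool) → EC f ≤ᵘ ↑ (fromℕ (C f))
-- A rational strictly above `C f` is strictly above the objective of `weights f`, so this one
-- feasible family witnesses that it lies above the infimum.
lemma10 n _ f q C<q = (weights f , feasible f) ,
  ↑-mono {objective (weights f)} {fromℕ (C f)} (objective≤C f) q C<q
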